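{- Let $n$ be an even positive integer and let $G=\mathrm{Cay}(\mathbb{Z}_n,S)$ be a circulant graph with $\Delta(G)\ge\frac n2$ whose generating set $S$ satisfies the following properties: (i) $S$ does not contain the involution $\frac n2$; (ii) $S$ has a subset $S_1=\{1,2,3,\ldots,\frac n4,\,n-\frac n4,\ldots,n-1\}$ (the generating set of the power of cycle $C_n^{n/4}$; in particular $\frac n4$ is an integer); (iii) the complement $S\setminus S_1$ generates the whole group $\mathbb{Z}_n$. Then $G$ satisfies the Total Coloring Conjecture, i.e. $\chi''(G)\le\Delta(G)+2$.
   Context: All graphs are finite, simple and undirected. For a group $H$ and a symmetric generating set $S\subset H$ (that is, $s\in S$ implies $s^{ -1}\in S$) not containing the identity, the Cayley graph $\mathrm{Cay}(H,S)$ has vertex set $H$ and edges joining $g$ and $gs$ for $g\in H$, $s\in S$. A circulant graph is a Cayley graph on the cyclic group $H=\mathbb{Z}_n$, whose elements are written $0,1,\ldots,n-1$. The power of cycle $C_n^k$ is the circulant graph on $\mathbb{Z}_n$ with generating set $\{1,2,\ldots,k,n-k,\ldots,n-2,n-1\}$. A total coloring of $G$ is a coloring of its vertices and edges such that no two adjacent vertices, no two adjacent edges, and no edge and a vertex incident with it receive the same color; $\chi''(G)$ is the minimum number of colors in a total coloring, and $\Delta(G)$ is the maximum degree. -}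

module Defs where

open import Algebra.Bundles using (Group)
open import Algebra.Core using (Op₁; Op₂)
open import Algebra.Structures using (IsGroup)
import Algebra.Properties.Group as GroupProperties
open import Data.Fin.Base as Fin using (Fin; toℕ; combine; join; splitAt)
import Data.Fin.Properties as Fin
open import Data.Fin.Subset using (Subset; _∈_; _∉_; ∣_∣)
open import Data.Fin.Subset.Properties using (_∈?_)
open import Data.List.Base using (map; allFin)
open import Data.List.Extrema.Nat using (max)
open import Data.Nat.Base
open import Data.Nat.DivMod
import Data.Nat.Properties as ℕ
open import Data.Product.Base using (∃; _×_; _,_; proj₁; proj₂)
open import Data.Sum.Base using (_⊎_; inj₁; inj₂)
import Data.Sum.Properties as Sum
open import Data.Vec.Base as Vec using (Vec; []; _∷_; tabulate; lookup)
open import Data.Vec.Properties using (lookup∘tabulate)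
open import Function.Base using (_∘_)
open import Level using (0ℓ)
open import Relation.Binary.Core using (Rel)
import Relation.Binary.Definitions as B
open import Relation.Binary.PropositionalEquality
open import Relation.Nullary.Decidable hiding (map)
open import Relation.Nullary.Negation using (¬_; contradiction)
open import Relation.Unary using (Pred; Decidable)

private
  variable
    n k : ℕ

fromPred : {P : Pred (Fin n) 0ℓ} → Decidable P → Subset n
fromPred P? = tabulate (does ∘ P?)

record Graph (n : ℕ) : Set₁ where
  infix 4 _~_ _~?_
  field
    _~_    : Rel (Fin n) 0ℓ
    _~?_   : B.Decidable _~_
    symm   : B.Symmetric _~_
    irrefl : ∀ {v} → ¬ (v ~ v)

  degree : Fin n → ℕ
  degree v = ∣ fromPred (v ~?_) ∣

  Δ : ℕ
  Δ = max 0 (map degree (allFin n))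

  -- An unordered edge is stored once, with its smaller endpoint first; the
  -- proof fields are irrelevant, so edges with the same endpoints are equal.
  record Edge : Set where
    constructor edge
    field
      tail head : Fin n
      .ordered  : tail Fin.< head
      .joined   : tail ~ head

  open Edge public

  Incident : Fin n → Edge → Set
  Incident v e = v ≡ tail e ⊎ v ≡ head e

  AdjacentEdges : Edge → Edge → Set
  AdjacentEdges e f = e ≢ f × ∃ λ v → Incident v e × Incident v f

  record IsTotalColouring (c : Fin n ⊎ Edge → Fin k) : Set where
    field
      vertex-vertex : ∀ u v → u ~ v → c (inj₁ u) ≢ c (inj₁ v)
      edge-edge     : ∀ e f → AdjacentEdges e f → c (inj₂ e) ≢ c (inj₂ f)
      vertex-edge   : ∀ v e → Incident v e → c (inj₁ v) ≢ c (inj₂ e)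

  TotalColourable : ℕ → Set
  TotalColourable k = ∃ λ (c : Fin n ⊎ Edge → Fin k) → IsTotalColouring c

IsLeast : Pred ℕ 0ℓ → Pred ℕ 0ℓ
IsLeast P k = P k × (∀ j → P j → k ≤ j)

least : {P : Pred ℕ 0ℓ} → Decidable P → ∀ b → P b → ∃ (IsLeast P)
least P? b pb with P? 0
... | yes p0 = 0 , p0 , λ _ _ → z≤n
least P? zero    pb | no ¬p0 = contradiction pb ¬p0
least P? (suc b) pb | no ¬p0 with least (P? ∘ suc) b pb
... | k , pk , k-min = suc k , pk , λ where
  zero    p0 → contradiction p0 ¬p0
  (suc j) pj → s≤s (k-min j pj)

Searchable : Set → Set₁
Searchable A = {P : Pred A 0ℓ} → Decidable P → Dec (∃ P)

search-Vec : {A : Set} → Searchable A → ∀ m → Searchable (Vec A m)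
search-Vec s zero    P? = map′ ([] ,_) (λ { ([] , p) → p }) (P? [])
search-Vec s (suc m) P? = map′
  (λ (x , xs , p) → x ∷ xs , p)
  (λ { (x ∷ xs , p) → x , xs , p })
  (s λ x → search-Vec s m λ xs → P? (x ∷ xs))

module _ (G : Graph n) where
  open Graph G

  private
    edge-≡ : ∀ {e f} → tail e ≡ tail f → head e ≡ head f → e ≡ f
    edge-≡ refl refl = refl

    _≟ₑ_ : B.DecidableEquality Edge
    e ≟ₑ f = map′ (λ (p , q) → edge-≡ p q) (λ { refl → refl , refl })
      ((tail e Fin.≟ tail f) ×-dec (head e Fin.≟ head f))

    allEdges? : {P : Pred Edge 0ℓ} → Decidable P → Dec (∀ e → P e)
    allEdges? {P} P? = map′
      (λ { h (edge u v p q) →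
           h u v (recompute (u Fin.<? v) p) (recompute (u ~? v) q) })
      (λ h u v p q → h (edge u v p q))
      (Fin.all? λ u → Fin.all? λ v → at u v)
      where
      at : ∀ u v → Dec ((p : u Fin.< v) (q : u ~ v) → P (edge u v p q))
      at u v with u Fin.<? v | u ~? v
      ... | no ¬p | _     = yes λ p _ → contradiction p ¬p
      ... | yes _ | no ¬q = yes λ _ q → contradiction q ¬q
      ... | yes p | yes q = map′ (λ x _ _ → x) (λ h → h p q) (P? (edge u v p q))

    incident? : B.Decidable Incident
    incident? v e = (v Fin.≟ tail e) ⊎-dec (v Fin.≟ head e)

    isTotalColouring? : (c : Fin n ⊎ Edge → Fin k) → Dec (IsTotalColouring c)
    isTotalColouring? c = map′
      (λ (p , q , r) → record
        { vertex-vertex = p ; edge-edge = q ; vertex-edge = r })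
      (λ t → let open IsTotalColouring t in
        vertex-vertex , edge-edge , vertex-edge)
      (Fin.all? (λ u → Fin.all? λ v → (u ~? v) →-dec
         ¬? (c (inj₁ u) Fin.≟ c (inj₁ v)))
       ×-dec
       allEdges? (λ e → allEdges? λ f →
         (¬? (e ≟ₑ f) ×-dec Fin.any? λ v → incident? v e ×-dec incident? v f)
         →-dec ¬? (c (inj₂ e) Fin.≟ c (inj₂ f)))
       ×-dec
       Fin.all? (λ v → allEdges? λ e → incident? v e →-dec
         ¬? (c (inj₁ v) Fin.≟ c (inj₂ e))))

    isTotalColouring-resp : {c d : Fin n ⊎ Edge → Fin k} → (∀ x → c x ≡ d x) →
           IsTotalColouring c → IsTotalColouring d
    isTotalColouring-resp {c = c} {d = d} c≗d t = record
      { vertex-vertex = λ u v a eq → vertex-vertex u v a (back eq)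
      ; edge-edge     = λ e f a eq → edge-edge e f a (back eq)
      ; vertex-edge   = λ v e a eq → vertex-edge v e a (back eq)
      }
      where
      open IsTotalColouring t
      back : ∀ {x y} → d x ≡ d y → c x ≡ c y
      back {x} {y} eq = trans (c≗d x) (trans eq (sym (c≗d y)))

    -- A colouring as finite data: a table of vertex colours and a square table
    -- of edge colours, whose entries at non-edges are never read.
    fromTables : Vec (Fin k) n → Vec (Vec (Fin k) n) n → Fin n ⊎ Edge → Fin k
    fromTables vs es (inj₁ v) = lookup vs v
    fromTables vs es (inj₂ e) = lookup (lookup es (tail e)) (head e)

    module _ (c : Fin n ⊎ Edge → Fin k) where
      entry : Fin n → Fin n → Fin k
      entry u v with u Fin.<? v | u ~? v
      ... | yes p | yes q = c (inj₂ (edge u v p q))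
      ... | _     | _     = c (inj₁ u)

      entry-edge : ∀ e → c (inj₂ e) ≡ entry (tail e) (head e)
      entry-edge (edge u v p q) with u Fin.<? v | u ~? v
      ... | yes _  | yes _  = refl
      ... | yes _  | no  ¬q = contradiction (recompute (u ~? v) q) ¬q
      ... | no  ¬p | _      = contradiction (recompute (u Fin.<? v) p) ¬p

      vertexTable : Vec (Fin k) n
      vertexTable = tabulate (c ∘ inj₁)

      edgeTable : Vec (Vec (Fin k) n) n
      edgeTable = tabulate λ u → tabulate (entry u)

      tables-correct : ∀ x → c x ≡ fromTables vertexTable edgeTable x
      tables-correct (inj₁ v) = sym (lookup∘tabulate (c ∘ inj₁) v)
      tables-correct (inj₂ e) = trans (entry-edge e) (sym (trans
        (cong (λ row → lookup row (head e))
          (lookup∘tabulate (λ u → tabulate (entry u)) (tail e)))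
        (lookup∘tabulate (entry (tail e)) (head e))))

  totalColourable? : Decidable TotalColourable
  totalColourable? k = map′
    (λ (vs , es , t) → fromTables vs es , t)
    (λ (c , t) → vertexTable c , edgeTable c , isTotalColouring-resp (tables-correct c) t)
    (search-Vec Fin.any? n λ vs →
     search-Vec (search-Vec Fin.any? n) n λ es →
     isTotalColouring? (fromTables vs es))

  private
    rainbow : Fin n ⊎ Edge → Fin (n + n * n)
    rainbow (inj₁ v) = join n (n * n) (inj₁ v)
    rainbow (inj₂ e) = join n (n * n) (inj₂ (combine (tail e) (head e)))

    join-injective : ∀ (x y : Fin n ⊎ Fin (n * n)) →
                     join n (n * n) x ≡ join n (n * n) y → x ≡ y
    join-injective x y eq = trans (sym (Fin.splitAt-join n (n * n) x))
      (trans (cong (splitAt n) eq) (Fin.splitAt-join n (n * n) y))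

  totalColourable-bound : TotalColourable (n + n * n)
  totalColourable-bound = rainbow , record
    { vertex-vertex = λ u v u~v eq → irrefl (subst (_~ v)
        (Sum.inj₁-injective (join-injective (inj₁ u) (inj₁ v) eq)) u~v)
    ; edge-edge     = λ e f (e≢f , _) eq →
        let p , q = Fin.combine-injective (tail e) (head e) (tail f) (head f)
                      (Sum.inj₂-injective (join-injective (inj₂ _) (inj₂ _) eq))
        in e≢f (edge-≡ p q)
    ; vertex-edge   = λ v e _ eq →
        contradiction (join-injective (inj₁ v) (inj₂ _) eq) λ ()
    }

  -- Colourability in some number of colours is decided by exhaustive search, so
  -- the minimum defining χ″ exists constructively, as an actual number.
  χ″-least : ∃ (IsLeast TotalColourable)
  χ″-least = least totalColourable? (n + n * n) totalColourable-bound

  χ″ : ℕ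
  χ″ = proj₁ χ″-least

record FiniteGroup (n : ℕ) : Set where
  infixl 7 _∙_
  infix  8 _⁻¹
  field
    _∙_     : Op₂ (Fin n)
    ε       : Fin n
    _⁻¹     : Op₁ (Fin n)
    isGroup : IsGroup _≡_ _∙_ ε _⁻¹

  group : Group 0ℓ 0ℓ
  group = record { isGroup = isGroup }

  open IsGroup isGroup public using (assoc; identityʳ; inverseʳ)

module _ (H : FiniteGroup n) where
  open FiniteGroup H

  -- The subgroup generated by T.
  data Generated (T : Subset n) : Fin n → Set where
    gen  : ∀ {g} → g ∈ T → Generated T g
    unit : Generated T ε
    mult : ∀ {g h} → Generated T g → Generated T h → Generated T (g ∙ h)
    inv  : ∀ {g} → Generated T g → Generated T (g ⁻¹)

  Generates : Subset n → Set
  Generates T = ∀ g → Generated T g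

  record IsSymmetricGeneratingSet (S : Subset n) : Set where
    field
      symmetric : ∀ {s} → s ∈ S → s ⁻¹ ∈ S
      ε∉        : ε ∉ S
      generates : Generates S

  Cay : (S : Subset n) → IsSymmetricGeneratingSet S → Graph n
  Cay S isSym = record
    { _~_    = λ g h → ∃ λ s → s ∈ S × h ≡ g ∙ s
    ; _~?_   = λ g h → Fin.any? λ s → (s ∈? S) ×-dec (h Fin.≟ g ∙ s)
    ; symm   = λ { {g} (s , s∈S , refl) → s ⁻¹ , symmetric s∈S , sym (begin
        g ∙ s ∙ s ⁻¹    ≡⟨ assoc g s (s ⁻¹) ⟩
        g ∙ (s ∙ s ⁻¹)  ≡⟨ cong (g ∙_) (inverseʳ s) ⟩
        g ∙ ε           ≡⟨ identityʳ g ⟩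
        g               ∎) }
    ; irrefl = λ { {g} (s , s∈S , g≡gs) →
        ε∉ (subst (_∈ S) (identityʳ-unique g s (sym g≡gs)) s∈S) }
    }
    where
    open IsSymmetricGeneratingSet isSym
    open GroupProperties group using (identityʳ-unique)
    open ≡-Reasoning

module _ (n : ℕ) .{{_ : NonZero n}} where

  private
    _⊕_ : Op₂ (Fin n)
    i ⊕ j = (toℕ i + toℕ j) mod n

    ⊖_ : Op₁ (Fin n)
    ⊖ i = (n ∸ toℕ i) mod n

    toℕ-mod : ∀ m → toℕ (m mod n) ≡ m % n
    toℕ-mod m = Fin.toℕ-fromℕ< (m%n<n m n)

    mod-cong : ∀ {a b} → a % n ≡ b % n → a mod n ≡ b mod n
    mod-cong {a} {b} eq =
      Fin.toℕ-injective (trans (toℕ-mod a) (trans eq (sym (toℕ-mod b))))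

    mod-toℕ : ∀ i → toℕ i mod n ≡ i
    mod-toℕ i =
      Fin.toℕ-injective (trans (toℕ-mod (toℕ i)) (m<n⇒m%n≡m (Fin.toℕ<n i)))

    absorb : ∀ a b → (a % n + b) % n ≡ (a + b) % n
    absorb a b = begin
      (a % n + b) % n          ≡⟨ %-distribˡ-+ (a % n) b n ⟩
      (a % n % n + b % n) % n  ≡⟨ cong (λ x → (x + b % n) % n) (m%n%n≡m%n a n) ⟩
      (a % n + b % n) % n      ≡⟨ %-distribˡ-+ a b n ⟨
      (a + b) % n              ∎
      where open ≡-Reasoning

    ⊕-comm : ∀ i j → i ⊕ j ≡ j ⊕ i
    ⊕-comm i j = cong (_mod n) (ℕ.+-comm (toℕ i) (toℕ j))

    mod-⊕ : ∀ a j → (a mod n) ⊕ j ≡ (a + toℕ j) mod n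
    mod-⊕ a j = mod-cong
      (trans (cong (λ x → (x + toℕ j) % n) (toℕ-mod a)) (absorb a (toℕ j)))

    ⊕-assoc : ∀ i j l → (i ⊕ j) ⊕ l ≡ i ⊕ (j ⊕ l)
    ⊕-assoc i j l = begin
      (i ⊕ j) ⊕ l                      ≡⟨ mod-⊕ (toℕ i + toℕ j) l ⟩
      (toℕ i + toℕ j + toℕ l) mod n    ≡⟨ cong (_mod n) (ℕ.+-assoc (toℕ i) _ _) ⟩
      (toℕ i + (toℕ j + toℕ l)) mod n  ≡⟨ cong (_mod n) (ℕ.+-comm (toℕ i) _) ⟩
      (toℕ j + toℕ l + toℕ i) mod n    ≡⟨ mod-⊕ (toℕ j + toℕ l) i ⟨
      (j ⊕ l) ⊕ i                      ≡⟨ ⊕-comm (j ⊕ l) i ⟩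
      i ⊕ (j ⊕ l)                      ∎
      where open ≡-Reasoning

    ⊕-identityˡ : ∀ i → (0 mod n) ⊕ i ≡ i
    ⊕-identityˡ i = trans (mod-⊕ 0 i) (mod-toℕ i)

    ⊕-inverseˡ : ∀ i → (⊖ i) ⊕ i ≡ 0 mod n
    ⊕-inverseˡ i = begin
      (⊖ i) ⊕ i                  ≡⟨ mod-⊕ (n ∸ toℕ i) i ⟩
      (n ∸ toℕ i + toℕ i) mod n  ≡⟨ cong (_mod n) (ℕ.m∸n+n≡m (ℕ.<⇒≤ (Fin.toℕ<n i))) ⟩
      n mod n                    ≡⟨ mod-cong ([m+n]%n≡m%n 0 n) ⟩
      0 mod n                    ∎
      where open ≡-Reasoning

  ℤ/_ : FiniteGroup n
  ℤ/_ = record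
    { _∙_     = _⊕_
    ; ε       = 0 mod n
    ; _⁻¹     = ⊖_
    ; isGroup = record
      { isMonoid = record
        { isSemigroup = record
          { isMagma = record
            { isEquivalence = isEquivalence
            ; ∙-cong        = cong₂ _⊕_
            }
          ; assoc = ⊕-assoc
          }
        ; identity = ⊕-identityˡ ,
                     λ i → trans (⊕-comm i (0 mod n)) (⊕-identityˡ i)
        }
      ; inverse = ⊕-inverseˡ ,
                  λ i → trans (⊕-comm i (⊖ i)) (⊕-inverseˡ i)
      ; ⁻¹-cong = cong ⊖_
      }
    }

-- The generating set of the power of cycle C_n^k.
cyclePowerSet : (n k : ℕ) → Subset n
cyclePowerSet n k = fromPred {P = λ i →
    (1 ≤ toℕ i × toℕ i ≤ k) ⊎ (n ∸ k ≤ toℕ i × toℕ i ≤ n ∸ 1)}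
  λ i → ((1 ℕ.≤? toℕ i) ×-dec (toℕ i ℕ.≤? k))
        ⊎-dec ((n ∸ k ℕ.≤? toℕ i) ×-dec (toℕ i ℕ.≤? n ∸ 1))

-- Let n = 4m. The residues ±1, …, ±(m − 1) in S₁ represent each nonzero class
-- modulo 2m other than m exactly once, so the total colouring a + b mod 2m + 1
-- of the complete graph on 2m vertices lifts to them, the nonadjacent vertices v
-- and v + 2m sharing a colour. The edges v — v + m form 4-cycles, coloured
-- alternately by the lifted colour and one further colour. A pair ±t in S ∖ S₁
-- duplicates the pair ±(2m − t) of S₁ modulo 2m. As t + (2m − t) has order 2,
-- one of t and 2m − t has even order in ℤ/4m; its cycles, of even length, take
-- two new colours, and the other one keeps the colours of the complete graph.
-- In total |S| + 2 colours are used, and S ∪ {0, 2m} serves as palette.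
{-# OPTIONS --safe #-}
module Submission where

open import Defs
open import Data.Fin.Subset using (Subset; _∉_; _⊆_; _─_)
open import Data.Nat using (ℕ; NonZero; _+_; _≤_; _≥_)
open import Data.Nat.DivMod using (_/_; _mod_)
open import Data.Nat.Divisibility using (_∣_)

open import Algebra.Structures using (IsGroup)
open import Data.Fin.Base as Fin using (Fin; zero; suc; toℕ; inject≤)
import Data.Fin.Properties as Fin
open import Data.Fin.Subset using (inside; outside; _∈_; _∪_; ⁅_⁆; ∣_∣)
open import Data.Fin.Subset.Properties
  using (_∈?_; x∈⁅x⁆; x∈p∪q⁺; ∣⁅x⁆∣≡1; ∣p∣≤∣x∷p∣; p⊆q⇒∣p∣≤∣q∣)
open import Data.List.Base using (map; allFin)
open import Data.List.Extrema.Nat using (xs≤max)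
open import Data.List.Membership.Propositional.Properties using (∈-map⁺; ∈-allFin)
import Data.List.Relation.Unary.All as All
open import Data.Nat.Base
open import Data.Nat.Coprimality using (Coprime; coprime-/gcd)
open import Data.Nat.DivMod
open import Data.Nat.Divisibility
open import Data.Nat.GCD using (gcd; gcd[m,n]∣m; gcd[m,n]∣n; gcd[m,n]≢0; gcd-greatest)
open import Data.Nat.Properties
open import Data.Nat.Tactic.RingSolver using (solve-∀)
open import Data.Parity.Base as ℙ using (Parity; 0ℙ; 1ℙ; _⁻¹)
import Data.Parity.Properties as ℙ
open import Data.Product.Base using (∃; _×_; _,_; proj₁; proj₂)
open import Data.Sum.Base using (_⊎_; inj₁; inj₂)
open import Data.Vec.Base using ([]; _∷_; here; there)
open import Data.Vec.Properties using (lookup⇒[]=; lookup∘tabulate)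
open import Function.Base using (_∘_)
open import Level using (0ℓ)
open import Relation.Binary.PropositionalEquality
open import Relation.Nullary.Decidable using (Dec; yes; no; dec-true; recompute; _×-dec_; _⊎-dec_)
open import Relation.Nullary.Negation using (¬_; contradiction)
open import Relation.Unary using (Pred; Decidable)

private
  variable
    k ν : ℕ

-- Members of finite sets and sizes of unions.

∈-fromPred : {P : Pred (Fin ν) 0ℓ} (P? : Decidable P) → ∀ {x} → P x → x ∈ fromPred P?
∈-fromPred P? {x} px = lookup⇒[]= x _ (trans (lookup∘tabulate _ x) (dec-true (P? x) px))

rank : {p : Subset ν} {x : Fin ν} → x ∈ p → Fin ∣ p ∣
rank                   here        = zero
rank {p = inside  ∷ p} (there x∈p) = suc (rank x∈p)
rank {p = outside ∷ p} (there x∈p) = rank x∈p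

rank-injective : {p : Subset ν} {x y : Fin ν} (x∈p : x ∈ p) (y∈p : y ∈ p) →
                 rank x∈p ≡ rank y∈p → x ≡ y
rank-injective                  here        here        _  = refl
rank-injective {p = inside  ∷ p} (there x∈p) (there y∈p) eq =
  cong suc (rank-injective x∈p y∈p (Fin.suc-injective eq))
rank-injective {p = outside ∷ p} (there x∈p) (there y∈p) eq =
  cong suc (rank-injective x∈p y∈p eq)

∣p∪q∣≤∣p∣+∣q∣ : (p q : Subset ν) → ∣ p ∪ q ∣ ≤ ∣ p ∣ + ∣ q ∣
∣p∪q∣≤∣p∣+∣q∣ []            []            = z≤n
∣p∪q∣≤∣p∣+∣q∣ (outside ∷ p) (outside ∷ q) = ∣p∪q∣≤∣p∣+∣q∣ p q
∣p∪q∣≤∣p∣+∣q∣ (outside ∷ p) (inside  ∷ q) =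
  ≤-trans (s≤s (∣p∪q∣≤∣p∣+∣q∣ p q)) (≤-reflexive (sym (+-suc ∣ p ∣ ∣ q ∣)))
∣p∪q∣≤∣p∣+∣q∣ (inside  ∷ p) (y       ∷ q) =
  s≤s (≤-trans (∣p∪q∣≤∣p∣+∣q∣ p q) (+-monoʳ-≤ ∣ p ∣ (∣p∣≤∣x∷p∣ y q)))

∣p∪⁅x⁆∪⁅y⁆∣≤∣p∣+2 : (p : Subset ν) (x y : Fin ν) → ∣ p ∪ (⁅ x ⁆ ∪ ⁅ y ⁆) ∣ ≤ ∣ p ∣ + 2
∣p∪⁅x⁆∪⁅y⁆∣≤∣p∣+2 p x y = ≤-trans (∣p∪q∣≤∣p∣+∣q∣ p (⁅ x ⁆ ∪ ⁅ y ⁆))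
  (+-monoʳ-≤ ∣ p ∣ (≤-trans (∣p∪q∣≤∣p∣+∣q∣ ⁅ x ⁆ ⁅ y ⁆)
    (≤-reflexive (cong₂ _+_ (∣⁅x⁆∣≡1 x) (∣⁅x⁆∣≡1 y)))))

-- Total colourings, palettes and the maximum degree.

module _ (G : Graph ν) where
  open Graph G

  -- The three conditions are inequalities, so they pass from `c` to any `d` that identifies no two
  -- elements separated by `c`.
  recolour : ∀ {j} {c : Fin ν ⊎ Edge → Fin k} {d : Fin ν ⊎ Edge → Fin j} →
             (∀ x y → d x ≡ d y → c x ≡ c y) → IsTotalColouring c → IsTotalColouring d
  recolour reflect t = record
    { vertex-vertex = λ u v u~v → vertex-vertex u v u~v ∘ reflect _ _
    ; edge-edge     = λ e f adj → edge-edge e f adj ∘ reflect _ _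
    ; vertex-edge   = λ v e inc → vertex-edge v e inc ∘ reflect _ _
    }
    where open IsTotalColouring t

  -- The colours are renamed by their ranks in `p`, which leaves at most `j` of them, and χ″ is
  -- minimal.
  χ″≤∣palette∣ : ∀ {j} {c : Fin ν ⊎ Edge → Fin k} → IsTotalColouring c →
                 (p : Subset k) → (∀ x → c x ∈ p) → ∣ p ∣ ≤ j → χ″ G ≤ j
  χ″≤∣palette∣ t p c∈p ∣p∣≤j with χ″-least G
  ... | _ , _ , minimal = minimal _ ((λ x → inject≤ (rank (c∈p x)) ∣p∣≤j) ,
    recolour (λ x y → rank-injective (c∈p x) (c∈p y) ∘ Fin.inject≤-injective ∣p∣≤j ∣p∣≤j _ _) t)

  degree≤Δ : ∀ v → degree v ≤ Δ
  degree≤Δ v = All.lookup (xs≤max 0 (map degree (allFin ν))) (∈-map⁺ degree (∈-allFin v))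

∣S∣≤Δ : (H : FiniteGroup ν) (S : Subset ν) (S-gen : IsSymmetricGeneratingSet H S) →
        ∣ S ∣ ≤ Graph.Δ (Cay H S S-gen)
∣S∣≤Δ H S S-gen = ≤-trans
  (p⊆q⇒∣p∣≤∣q∣ λ {x} x∈S → ∈-fromPred (ε ~?_) (x , x∈S , sym (IsGroup.identityˡ isGroup x)))
  (degree≤Δ (Cay H S S-gen) ε)
  where
  open FiniteGroup H
  open Graph (Cay H S S-gen)


-- Edges and their endpoints.

module _ {G : Graph ν} where
  open Graph G

  tail<head : ∀ e → tail e Fin.< head e
  tail<head (edge u v u<v _) = recompute (u Fin.<? v) u<v

  tail~head : ∀ e → tail e ~ head e
  tail~head (edge u v _ u~v) = recompute (u ~? v) u~v

  edge-cong : ∀ {e f} → tail e ≡ tail f → head e ≡ head f → e ≡ f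
  edge-cong refl refl = refl

  _Joins_,_ : Edge → Fin ν → Fin ν → Set
  e Joins v , w = tail e ≡ v × head e ≡ w ⊎ tail e ≡ w × head e ≡ v

  -- The tail is always the smaller endpoint, so two edges on the same endpoints cannot be stored in
  -- opposite directions.
  joins-unique : ∀ {v w} e f → e Joins v , w → f Joins v , w → e ≡ f
  joins-unique e f (inj₁ (refl , refl)) (inj₁ (t , h)) = edge-cong (sym t) (sym h)
  joins-unique e f (inj₂ (refl , refl)) (inj₂ (t , h)) = edge-cong (sym t) (sym h)
  joins-unique e f (inj₁ (refl , refl)) (inj₂ (t , h)) =
    contradiction (subst₂ Fin._<_ t h (tail<head f)) (<-asym (tail<head e))
  joins-unique e f (inj₂ (refl , refl)) (inj₁ (t , h)) =
    contradiction (subst₂ Fin._<_ t h (tail<head f)) (<-asym (tail<head e))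

-- Modular arithmetic and parity.

%-congʳ-+ : ∀ a b c k .{{_ : NonZero k}} → a % k ≡ b % k → (a + c) % k ≡ (b + c) % k
%-congʳ-+ a b c k eq = begin
  (a + c) % k          ≡⟨ %-distribˡ-+ a c k ⟩
  (a % k + c % k) % k  ≡⟨ cong (λ x → (x + c % k) % k) eq ⟩
  (b % k + c % k) % k  ≡⟨ %-distribˡ-+ b c k ⟨
  (b + c) % k          ∎
  where open ≡-Reasoning

%-congʳ-* : ∀ a b c k .{{_ : NonZero k}} → a % k ≡ b % k → (c * a) % k ≡ (c * b) % k
%-congʳ-* a b c k eq = begin
  (c * a) % k              ≡⟨ %-distribˡ-* c a k ⟩
  ((c % k) * (a % k)) % k  ≡⟨ cong (λ x → ((c % k) * x) % k) eq ⟩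
  ((c % k) * (b % k)) % k  ≡⟨ %-distribˡ-* c b k ⟨
  (c * b) % k              ∎
  where open ≡-Reasoning

-- With `k = suc j`, the term `a * j` acts as -a modulo `k`: added to both sides, it leaves a
-- multiple of `k` next to `b` and `c`.
%-+-cancelˡ : ∀ a {b c} k .{{_ : NonZero k}} → (a + b) % k ≡ (a + c) % k → b % k ≡ c % k
%-+-cancelˡ a {b} {c} k@(suc j) eq =
  trans (sym (drop b)) (trans (%-congʳ-+ (a + b) (a + c) (a * j) k eq) (drop c))
  where
  shift : ∀ a x j → a + x + a * j ≡ x + a * suc j
  shift = solve-∀
  drop : ∀ x → (a + x + a * j) % k ≡ x % k
  drop x = trans (cong (_% k) (shift a x j)) ([m+kn]%n≡m%n x a k)

-- The modulus 2m + 1 is odd, and `suc m` is the inverse of 2 modulo it.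
doubling-injective : ∀ m {a b} → a < suc (2 * m) → b < suc (2 * m) →
                     (a + a) % suc (2 * m) ≡ (b + b) % suc (2 * m) → a ≡ b
doubling-injective m {a} {b} a< b< eq =
  trans (sym (halve a a<)) (trans (%-congʳ-* (a + a) (b + b) (suc m) _ eq) (halve b b<))
  where
  expand : ∀ m a → suc m * (a + a) ≡ a + a * suc (2 * m)
  expand = solve-∀
  halve : ∀ a → a < suc (2 * m) → (suc m * (a + a)) % suc (2 * m) ≡ a
  halve a a< = trans (cong (_% suc (2 * m)) (expand m a))
    (trans ([m+kn]%n≡m%n a a (suc (2 * m))) (m<n⇒m%n≡m a<))

parity≡0ℙ⇒2∣ : ∀ k → parity k ≡ 0ℙ → 2 ∣ k
parity≡0ℙ⇒2∣ zero          _  = 2 ∣0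
parity≡0ℙ⇒2∣ (suc (suc k)) eq = ∣m∣n⇒∣m+n ∣-refl (parity≡0ℙ⇒2∣ k eq)

coprime⇒not-both-even : ∀ a b → Coprime a b → parity a ≡ 0ℙ → parity b ≡ 1ℙ
coprime⇒not-both-even a b coprime a-even with parity b in eq
... | 1ℙ = refl
... | 0ℙ = contradiction (coprime (parity≡0ℙ⇒2∣ a a-even , parity≡0ℙ⇒2∣ b eq)) λ ()

≢⁻¹⇒≡ : ∀ {x y} → x ≢ y ⁻¹ → x ≡ y
≢⁻¹⇒≡ {0ℙ} {0ℙ} _ = refl
≢⁻¹⇒≡ {1ℙ} {1ℙ} _ = refl
≢⁻¹⇒≡ {0ℙ} {1ℙ} h = contradiction refl h
≢⁻¹⇒≡ {1ℙ} {0ℙ} h = contradiction refl h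

-- Generators coded as steps.

-- step d r o g with d + r = m stands for the generator d, 2m − d, 4m − d or
-- 2m + d of ℤ/4m: g says whether it exceeds 2m, and o whether its distance to
-- 0 is 2m − d rather than d.
record Step : Set where
  constructor step
  field
    d r : ℕ
    o g : Parity

open Step

val : Step → ℕ
val (step d r 0ℙ 0ℙ) = d
val (step d r 1ℙ 0ℙ) = d + 2 * r
val (step d r 1ℙ 1ℙ) = 3 * d + 2 * r
val (step d r 0ℙ 1ℙ) = 3 * d + 4 * r

-- Negation in ℤ/4m keeps the distance to 0 and changes only the side.
reverse : Step → Step
reverse (step d r o g) = step d r o (g ⁻¹)

data Colour : Set where
  base new : ℕ → Colour

base-injective : ∀ {x y} → base x ≡ base y → x ≡ y
base-injective refl = refl

new-injective : ∀ {x y} → new x ≡ new y → x ≡ y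
new-injective refl = refl

module Colours (m : ℕ) .{{_ : NonZero m}} where

  N n : ℕ
  N = 2 * m
  n = m * 4

  instance
    N-nonZero : NonZero N
    N-nonZero = m*n≢0 2 m
    n-nonZero : NonZero n
    n-nonZero = m*n≢0 m 4

  gcd-nonZero : ∀ d → NonZero (gcd d N)
  gcd-nonZero d = ≢-nonZero (gcd[m,n]≢0 d N (inj₂ (≢-nonZero⁻¹ N)))

  -- For r = 0 the distances d and 2m - d are both m; `mid` then fixes o, so that every generator
  -- has only one code.
  record IsStep (c : Step) : Set where
    field
      sum : d c + r c ≡ m
      pos : 0 < d c
      mid : r c ≡ 0 → o c ≡ 0ℙ

  open IsStep

  -- The boundaries are chosen for `mid`: s = m falls into the first case and s = 3m into the last,
  -- both with o = 0ℙ.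
  decode : ℕ → Step
  decode s with s ≤? m | s <? N | s <? N + m
  ... | yes _ | _     | _     = step s (m ∸ s) 0ℙ 0ℙ
  ... | no _  | yes _ | _     = step (N ∸ s) (m ∸ (N ∸ s)) 1ℙ 0ℙ
  ... | no _  | no _  | yes _ = step (s ∸ N) (m ∸ (s ∸ N)) 1ℙ 1ℙ
  ... | no _  | no _  | no _  = step (n ∸ s) (m ∸ (n ∸ s)) 0ℙ 1ℙ

  private
    n≡N+N : n ≡ N + N
    n≡N+N = lemma m where
      lemma : ∀ m → m * 4 ≡ 2 * m + 2 * m
      lemma = solve-∀

    N≡m+m : N ≡ m + m
    N≡m+m = cong (m +_) (+-identityʳ m)

    r≢0 : ∀ {d o} → d < m → m ∸ d ≡ 0 → o ≡ 0ℙ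
    r≢0 d<m eq = contradiction (m∸n≡0⇒m≤n eq) (<⇒≱ d<m)

  decode-correct : ∀ s → 0 < s → s < n → s ≢ N → IsStep (decode s) × val (decode s) ≡ s
  decode-correct s 0<s s<n s≢N with s ≤? m | s <? N | s <? N + m
  ... | yes s≤m | _     | _     = record
    { sum = m+[n∸m]≡n s≤m ; pos = 0<s ; mid = λ _ → refl } , refl
  ... | no s≰m | yes s<N | _     = record
    { sum = sum′ ; pos = m<n⇒0<n∸m s<N ; mid = r≢0 d<m } ,
    +-cancelˡ-≡ e _ _ (trans (two e (m ∸ e)) (trans (cong (2 *_) sum′) (sym (m∸n+n≡m (<⇒≤ s<N)))))
    where
    e = N ∸ s
    d<m : e < m
    d<m = +-cancelʳ-< m e m (<-≤-trans (+-monoʳ-< e (≰⇒> s≰m))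
            (≤-reflexive (trans (m∸n+n≡m (<⇒≤ s<N)) N≡m+m)))
    sum′ = m+[n∸m]≡n (<⇒≤ d<m)
    two : ∀ d r → d + (d + 2 * r) ≡ 2 * (d + r)
    two = solve-∀
  ... | no _  | no s≮N | yes s<3m = record
    { sum = sum′ ; pos = m<n⇒0<n∸m (≤∧≢⇒< N≤s (≢-sym s≢N)) ; mid = r≢0 d<m } ,
    trans (two e (m ∸ e)) (trans (cong (λ x → e + 2 * x) sum′) (m∸n+n≡m N≤s))
    where
    e = s ∸ N
    N≤s = ≮⇒≥ s≮N
    d<m : e < m
    d<m = +-cancelˡ-< N e m (<-≤-trans (s≤s (≤-reflexive (m+[n∸m]≡n N≤s))) s<3m)
    sum′ = m+[n∸m]≡n (<⇒≤ d<m)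
    two : ∀ d r → 3 * d + 2 * r ≡ d + 2 * (d + r)
    two = solve-∀
  ... | no _  | no _  | no s≮3m  = record
    { sum = sum′ ; pos = m<n⇒0<n∸m s<n ; mid = λ _ → refl } ,
    +-cancelˡ-≡ e _ _ (trans (two e (m ∸ e)) (trans (cong (_* 4) sum′) (sym (m∸n+n≡m (<⇒≤ s<n)))))
    where
    e = n ∸ s
    3m≤s = ≮⇒≥ s≮3m
    d≤m : e ≤ m
    d≤m = +-cancelʳ-≤ (N + m) e m (≤-trans (+-monoʳ-≤ e 3m≤s)
            (≤-reflexive (trans (m∸n+n≡m (<⇒≤ s<n)) (four m))))
      where
      four : ∀ m → m * 4 ≡ m + (2 * m + m)
      four = solve-∀
    sum′ = m+[n∸m]≡n d≤m
    two : ∀ d r → d + (3 * d + 4 * r) ≡ (d + r) * 4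
    two = solve-∀

  reverse-isStep : ∀ {c} → IsStep c → IsStep (reverse c)
  reverse-isStep c-ok = record { sum = sum c-ok ; pos = pos c-ok ; mid = mid c-ok }

  val-reverse : ∀ {c} → IsStep c → val c + val (reverse c) ≡ n
  val-reverse {c} c-ok = trans (lemma c) (cong (_* 4) (sum c-ok))
    where
    inner : ∀ d r → d + (3 * d + 4 * r) ≡ (d + r) * 4
    inner = solve-∀
    outer : ∀ d r → d + 2 * r + (3 * d + 2 * r) ≡ (d + r) * 4
    outer = solve-∀
    lemma : ∀ c → val c + val (reverse c) ≡ (d c + r c) * 4
    lemma (step d r 0ℙ 0ℙ) = inner d r
    lemma (step d r 0ℙ 1ℙ) = trans (+-comm _ d) (inner d r)
    lemma (step d r 1ℙ 0ℙ) = outer d r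
    lemma (step d r 1ℙ 1ℙ) = trans (+-comm (3 * d + 2 * r) _) (outer d r)

  val>0 : ∀ {c} → IsStep c → 0 < val c
  val>0 {step d r 0ℙ 0ℙ} c-ok = pos c-ok
  val>0 {step d r 0ℙ 1ℙ} c-ok = <-≤-trans (pos c-ok) (m≤n⇒m≤n+o (4 * r) (m≤n*m d 3))
  val>0 {step d r 1ℙ 0ℙ} c-ok = <-≤-trans (pos c-ok) (m≤m+n d (2 * r))
  val>0 {step d r 1ℙ 1ℙ} c-ok = <-≤-trans (pos c-ok) (m≤n⇒m≤n+o (2 * r) (m≤n*m d 3))

  -- Residues of the generators modulo 2m.

  residue : ℕ → ℕ → Parity → ℕ
  residue d r 0ℙ = d
  residue d r 1ℙ = d + 2 * r

  residue<N : ∀ {d r} x → d + r ≡ m → 0 < d → residue d r x < N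
  residue<N {d} {r} x sum 0<d = ≤-trans (lemma x) (≤-reflexive (cong (2 *_) sum))
    where
    two : ∀ d r → d + (d + 2 * r) ≡ 2 * (d + r)
    two = solve-∀
    lemma : ∀ x → residue d r x < 2 * (d + r)
    lemma 1ℙ = ≤-trans (+-monoˡ-≤ (d + 2 * r) 0<d) (≤-reflexive (two d r))
    lemma 0ℙ = ≤-<-trans (m≤m+n d (2 * r)) (lemma 1ℙ)

  residue>0 : ∀ {d r} x → 0 < d → 0 < residue d r x
  residue>0 0ℙ 0<d = 0<d
  residue>0 {d} {r} 1ℙ 0<d = <-≤-trans 0<d (m≤m+n d (2 * r))

  -- The residue is d or 2m - d with d ≤ m, so it determines d, and the two forms agree only for d =
  -- m, that is, r = 0.
  residue-injective : ∀ {d r d′ r′} x x′ → d + r ≡ m → d′ + r′ ≡ m →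
    residue d r x ≡ residue d′ r′ x′ → d ≡ d′ × r ≡ r′ × (r ≡ 0 ⊎ x ≡ x′)
  residue-injective {d} {r} {d′} {r′} x x′ sum sum′ eq = cases x x′ eq
    where
    open ≡-Reasoning
    sums : d + r ≡ d′ + r′
    sums = trans sum (sym sum′)
    tail≡ : d ≡ d′ → r ≡ r′
    tail≡ refl = +-cancelˡ-≡ d _ _ sums
    split : ∀ a b → a + b + b ≡ a + 2 * b
    split = solve-∀
    cross : ∀ {d r d′ r′} → d + r ≡ d′ + r′ → d ≡ d′ + 2 * r′ → r′ + r ≡ 0
    cross {d} {r} {d′} {r′} sums eq = +-cancelˡ-≡ (d′ + r′) _ _ (begin
      d′ + r′ + (r′ + r)  ≡⟨ +-assoc (d′ + r′) r′ r ⟨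
      d′ + r′ + r′ + r    ≡⟨ cong (_+ r) (trans (split d′ r′) (sym eq)) ⟩
      d + r               ≡⟨ sums ⟩
      d′ + r′             ≡⟨ +-identityʳ _ ⟨
      d′ + r′ + 0         ∎)
    mixed : ∀ {d r d′ r′} → d + r ≡ d′ + r′ → d ≡ d′ + 2 * r′ → d ≡ d′ × r ≡ 0 × r′ ≡ 0
    mixed {d} {r} {d′} {r′} sums eq = trans eq (trans (cong (λ k → d′ + 2 * k) r′≡0) (+-identityʳ d′)) ,
      m+n≡0⇒n≡0 r′ (cross sums eq) , r′≡0
      where
      r′≡0 : r′ ≡ 0
      r′≡0 = m+n≡0⇒m≡0 r′ (cross sums eq)
    cases : ∀ x x′ → residue d r x ≡ residue d′ r′ x′ → d ≡ d′ × r ≡ r′ × (r ≡ 0 ⊎ x ≡ x′)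
    cases 0ℙ 0ℙ eq = eq , tail≡ eq , inj₂ refl
    cases 1ℙ 1ℙ eq = d≡ , r≡ , inj₂ refl
      where
      r≡ : r ≡ r′
      r≡ = +-cancelˡ-≡ (d + r) _ _ (begin
        d + r + r      ≡⟨ split d r ⟩
        d + 2 * r      ≡⟨ eq ⟩
        d′ + 2 * r′    ≡⟨ split d′ r′ ⟨
        d′ + r′ + r′   ≡⟨ cong (_+ r′) sums ⟨
        d + r + r′     ∎)
      d≡ : d ≡ d′
      d≡ = +-cancelʳ-≡ r _ _ (trans sums (cong (d′ +_) (sym r≡)))
    cases 0ℙ 1ℙ eq with mixed {d} {r} {d′} {r′} sums eq
    ... | d≡ , r≡0 , r′≡0 = d≡ , trans r≡0 (sym r′≡0) , inj₁ r≡0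
    cases 1ℙ 0ℙ eq with mixed {d′} {r′} {d} {r} (sym sums) (sym eq)
    ... | d′≡ , r′≡0 , r≡0 = sym d′≡ , trans r≡0 (sym r′≡0) , inj₁ r≡0

  val%N : ∀ {c} → IsStep c → val c % N ≡ residue (d c) (r c) (o c ℙ.+ g c)
  val%N {c@(step d r o g)} c-ok =
    trans (cong (_% N) (trans (lemma o g)
      (cong (λ z → residue d r (o ℙ.+ g) + wraps g * (2 * z)) (sum c-ok))))
      (trans ([m+kn]%n≡m%n _ (wraps g) N) (m<n⇒m%n≡m (residue<N (o ℙ.+ g) (sum c-ok) (pos c-ok))))
    where
    wraps : Parity → ℕ
    wraps 0ℙ = 0
    wraps 1ℙ = 1
    a01 : ∀ d r → 3 * d + 4 * r ≡ d + 2 * r + 1 * (2 * (d + r))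
    a01 = solve-∀
    a11 : ∀ d r → 3 * d + 2 * r ≡ d + 1 * (2 * (d + r))
    a11 = solve-∀
    lemma : ∀ o g → val (step d r o g) ≡ residue d r (o ℙ.+ g) + wraps g * (2 * (d + r))
    lemma 0ℙ 0ℙ = sym (+-identityʳ d)
    lemma 1ℙ 0ℙ = sym (+-identityʳ (d + 2 * r))
    lemma 0ℙ 1ℙ = a01 d r
    lemma 1ℙ 1ℙ = a11 d r

  -- The colouring of the complete graph.

  -- The edge colouring of the complete graph on N vertices by N + 1 colours,
  -- lifted along ℤ/4m → ℤ/2m; its diagonal colours the vertices.
  κ : ℕ → ℕ → ℕ
  κ v w = (v % N + w % N) % suc N

  κ-sym : ∀ v w → κ v w ≡ κ w v
  κ-sym v w = cong (_% suc N) (+-comm (v % N) (w % N))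

  κ<1+N : ∀ v w → κ v w < suc N
  κ<1+N v w = m%n<n (v % N + w % N) (suc N)

  %N<1+N : ∀ v → v % N < suc N
  %N<1+N v = m<n⇒m<1+n (m%n<n v N)

  -- Residues modulo N are smaller than N + 1, so cancelling `v % N` modulo N + 1 recovers them
  -- exactly.
  κ-injective : ∀ v {w w′} → κ v w ≡ κ v w′ → w % N ≡ w′ % N
  κ-injective v {w} {w′} eq =
    trans (sym (m<n⇒m%n≡m (%N<1+N w)))
      (trans (%-+-cancelˡ (v % N) (suc N) eq) (m<n⇒m%n≡m (%N<1+N w′)))

  N∣n : N ∣ n
  N∣n = subst (N ∣_) (sym n≡N+N) (∣m∣n⇒∣m+n ∣-refl ∣-refl)

  κ-step : ∀ v s t → κ v ((v + s) % n) ≡ κ v ((v + t) % n) → s % N ≡ t % N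
  κ-step v s t eq = %-+-cancelˡ v N (trans (sym (m∣n⇒o%n%m≡o%m N n (v + s) N∣n))
    (trans (κ-injective v eq) (m∣n⇒o%n%m≡o%m N n (v + t) N∣n)))

  -- Alternation along cycles of even length.

  level : ℕ → ℕ → Parity
  level d v = parity ((v / gcd d N) {{gcd-nonZero d}})

  -- The parity of d / gcd d N. It decides which of ±d and ±(2m - d) may get new colours: ±d when it
  -- is 1ℙ.
  slope : ℕ → Parity
  slope d = level d d

  private
    module _ (d : ℕ) where
      q : ℕ
      q = gcd d N

      instance
        q-nonZero : NonZero q
        q-nonZero = gcd-nonZero d

      d′ N′ : ℕ
      d′ = d / q
      N′ = N / q

      q∣d : q ∣ d
      q∣d = gcd[m,n]∣m d N

      q∣N : q ∣ N
      q∣N = gcd[m,n]∣n d N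

      d≡ : d ≡ d′ * q
      d≡ = sym (m/n*n≡m q∣d)

      N≡ : N ≡ N′ * q
      N≡ = sym (m/n*n≡m q∣N)

      not-both-even : parity d′ ≡ 0ℙ → parity N′ ≡ 1ℙ
      not-both-even = coprime⇒not-both-even d′ N′ (coprime-/gcd d N)

      -- Reads the parity of s / q off the sum d + s, which spares the subtractions in 2m - d and 4m
      -- - d.
      multiple : ∀ {s k} → d + s ≡ k * q →
                 ∃ λ j → s ≡ j * q × parity j ℙ.+ parity d′ ≡ parity k
      multiple {s} {k} eq with ∣m+n∣m⇒∣n {n = s} (divides k eq) q∣d
      ... | divides j refl = j , refl , trans (sym (ℙ.+-homo-+ j d′))
        (cong parity (*-cancelʳ-≡ (j + d′) k q (begin
          (j + d′) * q      ≡⟨ *-distribʳ-+ q j d′ ⟩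
          j * q + d′ * q    ≡⟨ cong (j * q +_) d≡ ⟨
          j * q + d         ≡⟨ +-comm (j * q) d ⟩
          d + j * q         ≡⟨ eq ⟩
          k * q             ∎)))
        where open ≡-Reasoning

      -- If d′ is odd, then d = d′q and 4m - d = (2N′ - d′)q are odd multiples of q. If d′ is even,
      -- N′ is odd by coprimality, and 2m ± d = (N′ ± d′)q are.
      odd-multiple : ∀ {r} o g → d + r ≡ m → o ≡ parity d′ ⁻¹ →
                     ∃ λ j → val (step d r o g) ≡ j * q × parity j ≡ 1ℙ
      odd-multiple {r} o g sum o≡ with parity d′ in eq
      odd-multiple {r} .0ℙ 0ℙ sum refl | 1ℙ = d′ , d≡ , eq
      odd-multiple {r} .0ℙ 1ℙ sum refl | 1ℙ
        with multiple {3 * d + 4 * r} {N′ + N′} (begin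
          d + (3 * d + 4 * r) ≡⟨ four d r ⟩
          2 * (d + r) + 2 * (d + r) ≡⟨ cong₂ _+_ 2sum≡ 2sum≡ ⟩
          N′ * q + N′ * q    ≡⟨ *-distribʳ-+ q N′ N′ ⟨
          (N′ + N′) * q      ∎)
        where
        open ≡-Reasoning
        2sum≡ = trans (cong (2 *_) sum) N≡
        four : ∀ d r → d + (3 * d + 4 * r) ≡ 2 * (d + r) + 2 * (d + r)
        four = solve-∀
      ... | j , s≡ , par = j , s≡ , ⁻¹≡0ℙ (begin
          parity j ℙ.+ 1ℙ       ≡⟨ cong (parity j ℙ.+_) eq ⟨
          parity j ℙ.+ parity d′ ≡⟨ par ⟩
          parity (N′ + N′)      ≡⟨ ℙ.+-homo-+ N′ N′ ⟩
          parity N′ ℙ.+ parity N′ ≡⟨ ℙ.p+p≡0ℙ (parity N′) ⟩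
          0ℙ                    ∎)
        where
        open ≡-Reasoning
        ⁻¹≡0ℙ : ∀ {x} → x ℙ.+ 1ℙ ≡ 0ℙ → x ≡ 1ℙ
        ⁻¹≡0ℙ {1ℙ} _ = refl
      odd-multiple {r} .1ℙ 0ℙ sum refl | 0ℙ
        with multiple {d + 2 * r} {N′} (trans (two d r) (trans (cong (2 *_) sum) N≡))
        where
        two : ∀ d r → d + (d + 2 * r) ≡ 2 * (d + r)
        two = solve-∀
      ... | j , s≡ , par = j , s≡ , (begin
          parity j              ≡⟨ ℙ.+-identityʳ _ ⟨
          parity j ℙ.+ 0ℙ        ≡⟨ cong (parity j ℙ.+_) eq ⟨
          parity j ℙ.+ parity d′ ≡⟨ par ⟩
          parity N′             ≡⟨ not-both-even eq ⟩
          1ℙ                    ∎)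
        where open ≡-Reasoning
      odd-multiple {r} .1ℙ 1ℙ sum refl | 0ℙ = N′ + d′ , (begin
          3 * d + 2 * r          ≡⟨ two d r ⟩
          2 * (d + r) + d        ≡⟨ cong₂ _+_ (trans (cong (2 *_) sum) N≡) d≡ ⟩
          N′ * q + d′ * q        ≡⟨ *-distribʳ-+ q N′ d′ ⟨
          (N′ + d′) * q          ∎) ,
          trans (ℙ.+-homo-+ N′ d′) (cong₂ ℙ._+_ (not-both-even eq) eq)
        where
        open ≡-Reasoning
        two : ∀ d r → 3 * d + 2 * r ≡ 2 * (d + r) + d
        two = solve-∀

      level-+ : ∀ v j → level d (v + j * q) ≡ level d v ℙ.+ parity j
      level-+ v j = trans (cong parity (trans (+-distrib-/-∣ʳ v {d = q} (divides j refl))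
                                        (cong (v / q +_) (m*n/n≡m j q))))
                          (ℙ.+-homo-+ (v / q) j)

      -- As n = 2N′q, reduction modulo n changes the quotient by q by an even number.
      level-% : ∀ v → level d (v % n) ≡ level d v
      level-% v = begin
        level d (v % n)                                 ≡⟨ ℙ.+-identityʳ _ ⟨
        level d (v % n) ℙ.+ 0ℙ                          ≡⟨ cong (level d (v % n) ℙ.+_) even ⟨
        level d (v % n) ℙ.+ parity (v / n * (N′ + N′))  ≡⟨ level-+ (v % n) (v / n * (N′ + N′)) ⟨
        level d (v % n + v / n * (N′ + N′) * q)         ≡⟨ cong (λ x → level d (v % n + x)) n-multiple ⟩
        level d (v % n + v / n * n)                     ≡⟨ cong (level d) (m≡m%n+[m/n]*n v n) ⟨
        level d v                                       ∎
        where
        open ≡-Reasoning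
        even : parity (v / n * (N′ + N′)) ≡ 0ℙ
        even = begin
          parity (v / n * (N′ + N′))                       ≡⟨ ℙ.*-homo-* (v / n) (N′ + N′) ⟩
          parity (v / n) ℙ.* parity (N′ + N′)              ≡⟨ cong (parity (v / n) ℙ.*_)
                                                                (trans (ℙ.+-homo-+ N′ N′) (ℙ.p+p≡0ℙ (parity N′))) ⟩
          parity (v / n) ℙ.* 0ℙ                            ≡⟨ ℙ.*-zeroʳ (parity (v / n)) ⟩
          0ℙ                                               ∎
        n-multiple : v / n * (N′ + N′) * q ≡ v / n * n
        n-multiple = trans (*-assoc (v / n) (N′ + N′) q) (cong (v / n *_) (begin
          (N′ + N′) * q        ≡⟨ *-distribʳ-+ q N′ N′ ⟩
          N′ * q + N′ * q      ≡⟨ cong₂ _+_ N≡ N≡ ⟨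
          N + N                ≡⟨ n≡N+N ⟨
          n                    ∎))

  -- Of d and 2m − d, one is an odd multiple of q = gcd d 2m, because their
  -- quotients by q are not both even; it generates cycles of even length, along
  -- which the parity of v / q alternates.
  level-flips : ∀ {c} v → IsStep c → o c ≡ slope (d c) ⁻¹ →
                level (d c) ((v + val c) % n) ≡ level (d c) v ⁻¹
  level-flips {c} v c-ok o≡ =
    let j , s≡ , j-odd = odd-multiple (d c) (o c) (g c) (sum c-ok) o≡ in begin
      level (d c) ((v + val c) % n)            ≡⟨ level-% (d c) (v + val c) ⟩
      level (d c) (v + val c)                  ≡⟨ cong (λ s → level (d c) (v + s)) s≡ ⟩
      level (d c) (v + j * gcd (d c) N)        ≡⟨ level-+ (d c) v j ⟩
      level (d c) v ℙ.+ parity j               ≡⟨ cong (level (d c) v ℙ.+_) j-odd ⟩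
      level (d c) v ℙ.+ 1ℙ                     ≡⟨ +1ℙ (level (d c) v) ⟩
      level (d c) v ⁻¹                         ∎
    where
    open ≡-Reasoning
    +1ℙ : ∀ x → x ℙ.+ 1ℙ ≡ x ⁻¹
    +1ℙ 0ℙ = refl
    +1ℙ 1ℙ = refl

  -- A step is congruent to d or 2m - d modulo N, and both lie strictly between 0 and N. Adjacent
  -- vertices thus lie over distinct vertices of the complete graph.
  κ-neighbour-≢ : ∀ {v c} → IsStep c → v % N ≢ (v + val c) % n % N
  κ-neighbour-≢ {v} {c} c-ok eq = m<n⇒n≢0 (residue>0 (o c ℙ.+ g c) (pos c-ok))
    (trans (sym (val%N c-ok)) (trans (%-+-cancelˡ v {val c} {0} N (begin
      (v + val c) % N      ≡⟨ m∣n⇒o%n%m≡o%m N n (v + val c) N∣n ⟨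
      (v + val c) % n % N  ≡⟨ eq ⟨
      v % N                ≡⟨ cong (_% N) (+-identityʳ v) ⟨
      (v + 0) % N          ∎)) (m<n⇒m%n≡m (>-nonZero⁻¹ N))))
    where open ≡-Reasoning

  -- Vertex colours are doubled residues modulo the odd number N + 1, where doubling is injective.
  vertex-vertex-≢ : ∀ {v c} → IsStep c → base (κ v v) ≢ base (κ ((v + val c) % n) ((v + val c) % n))
  vertex-vertex-≢ {v} {c} c-ok eq = κ-neighbour-≢ {v} c-ok
    (doubling-injective m (%N<1+N v) (%N<1+N ((v + val c) % n)) (base-injective eq))

  -- Encoding colours as residues modulo 4m.

  -- Base colours go to the residues within m of 0, new ones lie strictly between
  -- m and 3m.
  encode : Colour → ℕ
  encode (base x) with x ≤? m
  ... | yes _ = x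
  ... | no _  = pred x + N
  encode (new x) = x

  Proper : Colour → Set
  Proper (base x) = x ≤ N
  Proper (new x)  = m < x × x < N + m

  -- Puts the base colours above m at 3m or later, beyond every new colour.
  m≤pred : ∀ {x} → x ≰ m → m ≤ pred x
  m≤pred {x} x≰m = <⇒≤pred (≰⇒> x≰m)

  m<N : m < N
  m<N = subst (m <_) (sym N≡m+m) (m<m+n m (>-nonZero⁻¹ m))

  encode-injective : ∀ {x y} → Proper x → Proper y → encode x ≡ encode y → x ≡ y
  encode-injective {base x} {base y} _ _ eq with x ≤? m | y ≤? m
  ... | yes _ | yes _ = cong base eq
  ... | yes x≤m | no _ =
    contradiction (≤-trans (m≤n+m N (pred y)) (≤-reflexive (sym eq))) (<⇒≱ (≤-<-trans x≤m m<N))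
  ... | no _ | yes y≤m =
    contradiction (≤-trans (m≤n+m N (pred x)) (≤-reflexive eq)) (<⇒≱ (≤-<-trans y≤m m<N))
  encode-injective {base zero}    {_}           _ _ eq | no x≰m | no _ = contradiction z≤n x≰m
  encode-injective {base (suc _)} {base zero}   _ _ eq | no _ | no y≰m = contradiction z≤n y≰m
  encode-injective {base (suc x)} {base (suc y)} _ _ eq | no _ | no _ =
    cong (λ k → base (suc k)) (+-cancelʳ-≡ N x y eq)
  encode-injective {base x} {new y} _ (m<y , y<) eq with x ≤? m
  ... | yes x≤m = contradiction (≤-trans (≤-reflexive (sym eq)) x≤m) (<⇒≱ m<y)
  ... | no x≰m = contradiction (≤-trans (+-monoˡ-≤ N (m≤pred x≰m)) (≤-reflexive eq))
                   (<⇒≱ (subst (y <_) (+-comm N m) y<))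
  encode-injective {new x} {base y} x-ok y-ok eq =
    sym (encode-injective {base y} {new x} y-ok x-ok (sym eq))
  encode-injective {new x} {new y} _ _ eq = cong new eq

  N+m≤n : N + m ≤ n
  N+m≤n = ≤-trans (+-monoʳ-≤ N (<⇒≤ m<N)) (≤-reflexive (sym n≡N+N))

  encode<n : ∀ {x} → Proper x → encode x < n
  encode<n {new x} (_ , x<) = <-≤-trans x< N+m≤n
  encode<n {base x} x≤N with x ≤? m
  ... | yes x≤m = <-≤-trans (≤-<-trans x≤m m<N) (≤-trans (m≤m+n N m) N+m≤n)
  encode<n {base zero}    _   | no x≰m = contradiction z≤n x≰m
  encode<n {base (suc x)} x<N | no _   = subst (x + N <_) (sym n≡N+N) (+-monoˡ-< N x<N)

  beyond-N : ∀ d r → d + r ≡ m → val (step d r 1ℙ 1ℙ) ≡ d + N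
  beyond-N d r sum = trans (lemma d r) (cong (λ k → d + 2 * k) sum)
    where
    lemma : ∀ d r → 3 * d + 2 * r ≡ d + 2 * (d + r)
    lemma = solve-∀

  below-N : ∀ {d r} → d + r ≡ m → 0 < d → val (step d r 1ℙ 0ℙ) < N
  below-N = residue<N 1ℙ

  -- The numbers are N - d and N + d with d > 0: the side of N gives x, and the distance from N
  -- gives d.
  outer-injective : ∀ {d r d′ r′} x x′ → d + r ≡ m → d′ + r′ ≡ m → 0 < d → 0 < d′ →
                    val (step d r 1ℙ x) ≡ val (step d′ r′ 1ℙ x′) → d ≡ d′ × r ≡ r′ × x ≡ x′
  outer-injective 0ℙ 0ℙ sum sum′ _ _ eq with residue-injective 1ℙ 1ℙ sum sum′ eq
  ... | d≡ , r≡ , _ = d≡ , r≡ , refl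
  outer-injective {d} {r} {d′} {r′} 1ℙ 1ℙ sum sum′ _ _ eq
    with +-cancelʳ-≡ N d d′ (trans (sym (beyond-N d r sum)) (trans eq (beyond-N d′ r′ sum′)))
  ... | refl = refl , +-cancelˡ-≡ d r r′ (trans sum (sym sum′)) , refl
  outer-injective {d} {r} {d′} {r′} 0ℙ 1ℙ sum sum′ 0<d _ eq = contradiction
    (≤-trans (m≤n+m N d′) (≤-reflexive (sym (trans eq (beyond-N d′ r′ sum′))))) (<⇒≱ (below-N sum 0<d))
  outer-injective {d} {r} {d′} {r′} 1ℙ 0ℙ sum sum′ _ 0<d′ eq = contradiction
    (≤-trans (m≤n+m N d) (≤-reflexive (trans (sym (beyond-N d r sum)) eq))) (<⇒≱ (below-N sum′ 0<d′))

  -- Keeps N free as the further colour of the 4-cycles.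
  N≢outer : ∀ {d r} x → d + r ≡ m → 0 < d → N ≢ val (step d r 1ℙ x)
  N≢outer 0ℙ sum 0<d eq = <-irrefl (sym eq) (below-N sum 0<d)
  N≢outer {d} {r} 1ℙ sum 0<d eq = <-irrefl (trans eq (beyond-N d r sum)) (+-monoˡ-≤ N 0<d)

  -- r = 0 forces d = d′ = m, and `mid` fixes o; only g separates the steps m and 3m, and the common
  -- level cancels.
  middle-unique : ∀ {d o g d′ o′ g′} v → IsStep (step d 0 o g) → IsStep (step d′ 0 o′ g′) →
    g ℙ.+ level d v ≡ g′ ℙ.+ level d′ v → step d 0 o g ≡ step d′ 0 o′ g′
  middle-unique {d} {g = g} {d′ = d′} {g′ = g′} v c-ok c′-ok eq
    with mid c-ok refl | mid c′-ok refl | +-cancelʳ-≡ 0 d d′ (trans (sum c-ok) (sym (sum c′-ok)))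
  ... | refl | refl | refl with ℙ.+-cancelʳ-≡ (level d v) g g′ eq
  ... | refl = refl

  -- The colouring of the edges.

  module Colouring (inS : ℕ → Set) (inS? : Decidable inS)
                   (inS-sym : ∀ {s t} → s + t ≡ n → 0 < t → inS s → inS t)
                   (inS-small : ∀ {s} → 0 < s → s ≤ m → inS s)
    where

    -- If d + 2r = 2m - d is in S, then ±d and ±(2m - d) both occur and collide modulo 2m; the
    -- second condition selects the pair along which `level d` alternates.
    Twisted : Step → Set
    Twisted (step d r o g) = inS (d + 2 * r) × o ≡ slope d ⁻¹

    twisted? : Decidable Twisted
    twisted? (step d r o g) = inS? (d + 2 * r) ×-dec (o ℙ.≟ slope d ⁻¹)

    -- r = 0 means d = m: the edges v — v + m, in 4-cycles.
    tint : ℕ → ℕ → Parity → ℕ → Colour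
    tint d zero    0ℙ k = new N
    tint d zero    1ℙ k = base k
    tint d (suc r) x  k = new (val (step d (suc r) 1ℙ x))

    paint : ℕ → ℕ → Step → {A : Set} → Dec A → Colour
    paint v w (step d r o g) (yes _) = tint d r (g ℙ.+ level d v) (κ v w)
    paint v w (step d r o g) (no _)  = base (κ v w)

    colour : ℕ → ℕ → Step → Colour
    colour v w c = paint v w c (twisted? c)

    -- The reason for an edge's colour, so that clashes can be settled by pairs of reasons. In
    -- `fresh` the two new colours are named by the generators 2m - d and 2m + d, even when the
    -- edges step by ±d.
    data Shade (v w : ℕ) : Step → Colour → Set where
      plain  : ∀ {c} → ¬ Twisted c → Shade v w c (base (κ v w))
      square : ∀ {d o g} → g ℙ.+ level d v ≡ 1ℙ → Shade v w (step d 0 o g) (base (κ v w))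
      middle : ∀ {d o g} → g ℙ.+ level d v ≡ 0ℙ → Shade v w (step d 0 o g) (new N)
      fresh  : ∀ {d r o g} → Twisted (step d (suc r) o g) →
               Shade v w (step d (suc r) o g) (new (val (step d (suc r) 1ℙ (g ℙ.+ level d v))))

    shade : ∀ v w c → Shade v w c (colour v w c)
    shade v w c@(step d r o g) = cases r (twisted? c)
      where
      four : ∀ x → g ℙ.+ level d v ≡ x → Shade v w (step d 0 o g) (tint d 0 x (κ v w))
      four 0ℙ eq = middle eq
      four 1ℙ eq = square eq
      cases : ∀ r (t? : Dec (Twisted (step d r o g))) →
              Shade v w (step d r o g) (paint v w (step d r o g) t?)
      cases r       (no ¬t) = plain ¬t
      cases zero    (yes _) = four _ refl
      cases (suc r) (yes t) = fresh t

    -- Seen from the other end, g is reversed and, for a twisted step, so is the level; their sum,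
    -- which selects the colour, stays the same.
    colour-reverse : ∀ {v w c} → IsStep c → w ≡ (v + val c) % n →
                     colour v w c ≡ colour w v (reverse c)
    colour-reverse {v} {w} {c@(step d r o g)} c-ok refl = cases (twisted? c)
      where
      open ≡-Reasoning
      both-flip : ∀ x y → x ℙ.+ y ≡ x ⁻¹ ℙ.+ y ⁻¹
      both-flip 0ℙ 0ℙ = refl
      both-flip 0ℙ 1ℙ = refl
      both-flip 1ℙ 0ℙ = refl
      both-flip 1ℙ 1ℙ = refl
      -- `Twisted` does not look at g, so one decision serves both `c` and `reverse c`.
      cases : (t? : Dec (Twisted c)) → paint v w c t? ≡ paint w v (reverse c) t?
      cases (no _) = cong base (κ-sym v w)
      cases (yes (_ , o≡)) = cong₂ (tint d r) (begin
        g ℙ.+ level d v         ≡⟨ both-flip g (level d v) ⟩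
        g ⁻¹ ℙ.+ level d v ⁻¹   ≡⟨ cong (g ⁻¹ ℙ.+_) (level-flips v c-ok o≡) ⟨
        g ⁻¹ ℙ.+ level d w      ∎) (κ-sym v w)

    -- Here d = m divides N, so d / gcd d N = 1 is odd and the slope selects o = 0ℙ, the value that
    -- `mid` prescribes.
    middle-twisted : ∀ {d o g} → IsStep (step d 0 o g) → Twisted (step d 0 o g)
    middle-twisted {d} {o} c-ok =
      subst inS (sym (+-identityʳ d)) (inS-small (pos c-ok) (≤-reflexive d≡m)) ,
      trans (mid c-ok refl) (sym (cong (λ x → parity x ⁻¹) ratio))
      where
      d≡m : d ≡ m
      d≡m = trans (sym (+-identityʳ d)) (sum c-ok)
      instance
        d-nonZero : NonZero d
        d-nonZero = >-nonZero (pos c-ok)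
      gcd≡d : gcd d N ≡ d
      gcd≡d = ∣-antisym (gcd[m,n]∣m d N)
                (gcd-greatest ∣-refl (subst (λ x → d ∣ 2 * x) d≡m (n∣m*n 2)))
      ratio : (d / gcd d N) {{gcd-nonZero d}} ≡ 1
      ratio = trans (/-congʳ {{gcd-nonZero d}} gcd≡d) (n/n≡1 d)

    outer : ∀ {d r g} → IsStep (step d r 1ℙ g) → inS (val (step d r 1ℙ g)) → inS (d + 2 * r)
    outer {g = 0ℙ} c-ok s∈S = s∈S
    outer {d} {r} {1ℙ} c-ok s∈S =
      inS-sym (val-reverse c-ok) (<-≤-trans (pos c-ok) (m≤m+n d (2 * r))) s∈S

    inner : ∀ {d r o g} → IsStep (step d r o g) → inS (val (step d r o g)) → ¬ inS (d + 2 * r) → o ≡ 0ℙ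
    inner {o = 0ℙ} _    _   _   = refl
    inner {o = 1ℙ} c-ok s∈S t∉S = contradiction (outer c-ok s∈S) t∉S

    -- If 2m - d is in S, an untwisted step must have the one o that twisting leaves over; otherwise
    -- neither of 2m ± d is in S, which means o = 0ℙ.
    plain-unique : ∀ {d r o g o′ g′} →
      IsStep (step d r o g) → IsStep (step d r o′ g′) →
      inS (val (step d r o g)) → inS (val (step d r o′ g′)) →
      ¬ Twisted (step d r o g) → ¬ Twisted (step d r o′ g′) → o ≡ o′
    plain-unique {d} {r} c-ok c′-ok s∈S s′∈S ¬t ¬t′ with inS? (d + 2 * r)
    ... | yes t∈S = trans (≢⁻¹⇒≡ λ o≡ → ¬t (t∈S , o≡)) (sym (≢⁻¹⇒≡ λ o≡ → ¬t′ (t∈S , o≡)))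
    ... | no t∉S  = trans (inner c-ok s∈S t∉S) (sym (inner c′-ok s′∈S t∉S))

    -- For two plain steps, equal colours force equal residues modulo 2m, hence the same d and o +
    -- g, and `plain-unique` then separates o from g. Equal fresh colours give back d and the sum of
    -- g and the level, while twisting fixes o.
    locally-injective : ∀ {v c c′ x x′} → IsStep c → IsStep c′ → inS (val c) → inS (val c′) →
      Shade v ((v + val c) % n) c x → Shade v ((v + val c′) % n) c′ x′ → x ≡ x′ → c ≡ c′
    locally-injective {v} {c} {c′} c-ok c′-ok s∈S s′∈S h h′ x≡x′ = cases h h′ x≡x′ where
      same : κ v ((v + val c) % n) ≡ κ v ((v + val c′) % n) →
             d c ≡ d c′ × r c ≡ r c′ × (r c ≡ 0 ⊎ o c ℙ.+ g c ≡ o c′ ℙ.+ g c′)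
      same eq = residue-injective _ _ (sum c-ok) (sum c′-ok)
        (trans (sym (val%N c-ok)) (trans (κ-step v (val c) (val c′) eq) (val%N c′-ok)))
      cases : ∀ {x x′} → Shade v ((v + val c) % n) c x → Shade v ((v + val c′) % n) c′ x′ →
              x ≡ x′ → c ≡ c′
      cases (plain ¬t) (plain ¬t′) eq with same (base-injective eq)
      ... | refl , refl , inj₁ refl = contradiction (middle-twisted c-ok) ¬t
      ... | refl , refl , inj₂ o+g≡ with plain-unique c-ok c′-ok s∈S s′∈S ¬t ¬t′
      ... | refl with ℙ.+-cancelˡ-≡ (o c) (g c) (g c′) o+g≡
      ... | refl = refl
      -- Equal residues would give the plain step r = 0 as well, but such steps are always twisted.
      cases (plain ¬t) (square _) eq with same (base-injective eq)
      ... | refl , refl , _ = contradiction (middle-twisted c-ok) ¬t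
      cases (square _) (plain ¬t′) eq with same (base-injective eq)
      ... | refl , refl , _ = contradiction (middle-twisted c′-ok) ¬t′
      cases (square p) (square p′) _ = middle-unique v c-ok c′-ok (trans p (sym p′))
      cases (middle p) (middle p′) _ = middle-unique v c-ok c′-ok (trans p (sym p′))
      cases (middle _) (fresh {d′} {g = g′} _) eq =
        contradiction (new-injective eq) (N≢outer (g′ ℙ.+ level d′ v) (sum c′-ok) (pos c′-ok))
      cases (fresh {d} {g = g} _) (middle _) eq =
        contradiction (sym (new-injective eq)) (N≢outer (g ℙ.+ level d v) (sum c-ok) (pos c-ok))
      cases (fresh {d} {g = g} (_ , o≡)) (fresh {d′} {g = g′} (_ , o′≡)) eq
        with outer-injective (g ℙ.+ level d v) (g′ ℙ.+ level d′ v)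
               (sum c-ok) (sum c′-ok) (pos c-ok) (pos c′-ok) (new-injective eq)
      ... | refl , refl , x≡ with trans o≡ (sym o′≡) | ℙ.+-cancelʳ-≡ (level d v) g g′ x≡
      ... | refl | refl = refl

    -- Vertices carry the diagonal of κ, so a clash with a base colour would make the two ends
    -- congruent modulo N.
    vertex-edge-≢ : ∀ {v c x} → IsStep c → Shade v ((v + val c) % n) c x → base (κ v v) ≢ x
    vertex-edge-≢ {v} c-ok (plain _)  eq = κ-neighbour-≢ {v} c-ok (κ-injective v (base-injective eq))
    vertex-edge-≢ {v} c-ok (square _) eq = κ-neighbour-≢ {v} c-ok (κ-injective v (base-injective eq))

    -- The palette.

    Palette : ℕ → Set
    Palette k = inS k ⊎ k ≡ 0 ⊎ k ≡ N

    base-palette : ∀ {x} → x ≤ N → Palette (encode (base x))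
    base-palette {x} x≤N with x ≤? m
    base-palette {zero}  _   | yes _   = inj₂ (inj₁ refl)
    base-palette {suc x} _   | yes x≤m = inj₁ (inS-small z<s x≤m)
    base-palette {zero}  _   | no x≰m  = contradiction z≤n x≰m
    base-palette {suc x} x<N | no x≰m  =
      -- `x + N` is the negative of N - x, which lies between 1 and m.
      inj₁ (inS-sym (trans (lemma (N ∸ x)) (trans (cong (_+ N) (m∸n+n≡m (<⇒≤ x<N))) (sym n≡N+N)))
        (<-≤-trans (>-nonZero⁻¹ N) (m≤n+m N x))
        (inS-small (m<n⇒0<n∸m x<N)
          (m≤n+o⇒m∸n≤o N x (≤-trans (≤-reflexive N≡m+m) (+-monoˡ-≤ m (m≤pred x≰m))))))
      where
      lemma : ∀ k → k + (x + N) ≡ k + x + N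
      lemma k = sym (+-assoc k x N)

    -- In `fresh` the successor forces d < m, so 2m - d and 2m + d lie strictly between m and 3m.
    shade-proper : ∀ {v w c x} → IsStep c → Shade v w c x → Proper x
    shade-proper {v} {w} _ (plain _)  = ≤-pred (κ<1+N v w)
    shade-proper {v} {w} _ (square _) = ≤-pred (κ<1+N v w)
    shade-proper _    (middle _) = m<N , m<m+n N (>-nonZero⁻¹ m)
    shade-proper {v} c-ok (fresh {d} {r} {g = g} _) = cases (g ℙ.+ level d v)
      where
      d<m : d < m
      d<m = <-≤-trans (m<m+n d z<s) (≤-reflexive (sum c-ok))
      split : ∀ d r → d + r + r ≡ d + 2 * r
      split = solve-∀
      cases : ∀ x → Proper (new (val (step d (suc r) 1ℙ x)))
      cases 0ℙ = <-≤-trans (m<m+n m {suc r} z<s)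
                   (≤-reflexive (trans (cong (_+ suc r) (sym (sum c-ok))) (split d (suc r)))) ,
                 <-≤-trans (below-N (sum c-ok) (pos c-ok)) (m≤m+n N m)
      cases 1ℙ = subst (λ k → m < k × k < N + m)
                   (sym (trans (beyond-N d (suc r) (sum c-ok)) (+-comm d N)))
                   (<-≤-trans m<N (m≤m+n N d) , +-monoʳ-< N d<m)

    -- A fresh colour occurs only if 2m - d is in S, and by symmetry 2m + d is then in S too.
    shade-palette : ∀ {v w c x} → IsStep c → Shade v w c x → Palette (encode x)
    shade-palette {v} {w} _ (plain _)  = base-palette (≤-pred (κ<1+N v w))
    shade-palette {v} {w} _ (square _) = base-palette (≤-pred (κ<1+N v w))
    shade-palette _ (middle _) = inj₂ (inj₂ refl)
    shade-palette {v} c-ok (fresh {d} {r} {g = g} (t∈S , _)) = inj₁ (cases (g ℙ.+ level d v))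
      where
      t-ok : IsStep (step d (suc r) 1ℙ 0ℙ)
      t-ok = record { sum = sum c-ok ; pos = pos c-ok ; mid = λ () }
      cases : ∀ x → inS (val (step d (suc r) 1ℙ x))
      cases 0ℙ = t∈S
      cases 1ℙ = inS-sym (val-reverse t-ok) (<-≤-trans (pos c-ok) (m≤n⇒m≤n+o _ (m≤n*m d 3))) t∈S

-- Passage to the circulant graph.

toℕ-mod : ∀ a n .{{_ : NonZero n}} → toℕ (a mod n) ≡ a % n
toℕ-mod a n = Fin.toℕ-fromℕ< (m%n<n a n)

toℕ-mod-< : ∀ {a n} .{{_ : NonZero n}} → a < n → toℕ (a mod n) ≡ a
toℕ-mod-< {a} {n} a<n = trans (toℕ-mod a n) (m<n⇒m%n≡m a<n)

mod-toℕ : ∀ {n} .{{_ : NonZero n}} (i : Fin n) → toℕ i mod n ≡ i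
mod-toℕ i = Fin.toℕ-injective (toℕ-mod-< (Fin.toℕ<n i))

-- Both v - u and s lie below n and are congruent modulo n. So the generator of an edge can be read
-- off its stored endpoints.
difference≡ : ∀ {n} .{{_ : NonZero n}} (u v s : Fin n) → toℕ u < toℕ v →
              v ≡ (toℕ u + toℕ s) mod n → toℕ v ∸ toℕ u ≡ toℕ s
difference≡ {n} u v s u<v refl = begin
  D            ≡⟨ m<n⇒m%n≡m (≤-<-trans (m∸n≤m (toℕ v) (toℕ u)) (Fin.toℕ<n v)) ⟨
  D % n        ≡⟨ %-+-cancelˡ (toℕ u) n (begin
    (toℕ u + D) % n      ≡⟨ cong (_% n) (m+[n∸m]≡n (<⇒≤ u<v)) ⟩
    toℕ v % n            ≡⟨ m<n⇒m%n≡m (Fin.toℕ<n v) ⟩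
    toℕ v                ≡⟨ toℕ-mod (toℕ u + toℕ s) n ⟩
    (toℕ u + toℕ s) % n  ∎) ⟩
  toℕ s % n    ≡⟨ m<n⇒m%n≡m (Fin.toℕ<n s) ⟩
  toℕ s        ∎
  where
  open ≡-Reasoning
  D = toℕ v ∸ toℕ u

∈-cyclePowerSet : ∀ n k {i : Fin n} → 1 ≤ toℕ i → toℕ i ≤ k → i ∈ cyclePowerSet n k
∈-cyclePowerSet n k 1≤i i≤k = ∈-fromPred
  (λ i → ((1 ≤? toℕ i) ×-dec (toℕ i ≤? k)) ⊎-dec ((n ∸ k ≤? toℕ i) ×-dec (toℕ i ≤? n ∸ 1)))
  (inj₁ (1≤i , i≤k))

module Circulant (m : ℕ) .{{_ : NonZero m}} .{{_ : NonZero (m * 4)}}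
  (S : Subset (m * 4)) (S-gen : IsSymmetricGeneratingSet (ℤ/ (m * 4)) S)
  (half∉S : ((2 * m) mod (m * 4)) ∉ S)
  (S₁⊆S : cyclePowerSet (m * 4) m ⊆ S)
  where

  open Colours m hiding (n-nonZero)

  G : Graph n
  G = Cay (ℤ/ n) S S-gen

  open Graph G
  open IsSymmetricGeneratingSet S-gen

  inS : ℕ → Set
  inS s = s mod n ∈ S

  inS-sym : ∀ {s t} → s + t ≡ n → 0 < t → inS s → inS t
  inS-sym {s} {t} s+t≡n 0<t s∈S = subst (_∈ S) (cong (_mod n) (begin
    n ∸ toℕ (s mod n)  ≡⟨ cong (n ∸_) (toℕ-mod-< (subst (s <_) s+t≡n (m<m+n s 0<t))) ⟩
    n ∸ s              ≡⟨ cong (_∸ s) s+t≡n ⟨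
    s + t ∸ s          ≡⟨ m+n∸m≡n s t ⟩
    t                  ∎)) (symmetric s∈S)
    where open ≡-Reasoning

  inS-small : ∀ {s} → 0 < s → s ≤ m → inS s
  inS-small {s} 0<s s≤m = S₁⊆S (∈-cyclePowerSet n m
    (subst (1 ≤_) (sym s≡) 0<s) (subst (_≤ m) (sym s≡) s≤m))
    where
    s≡ : toℕ (s mod n) ≡ s
    s≡ = toℕ-mod-< (≤-<-trans s≤m (<-≤-trans m<N (≤-trans (m≤m+n N m) N+m≤n)))

  open Colouring inS (λ s → s mod n ∈? S) inS-sym inS-small

  step-of : ∀ {s} → s ∈ S → IsStep (decode (toℕ s)) × val (decode (toℕ s)) ≡ toℕ s
  step-of {s} s∈S = decode-correct (toℕ s) (n≢0⇒n>0 s≢0) (Fin.toℕ<n s) s≢N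
    where
    s≢0 : toℕ s ≢ 0
    s≢0 s≡0 = ε∉ (subst (_∈ S) (trans (sym (mod-toℕ s)) (cong (_mod n) s≡0)) s∈S)
    s≢N : toℕ s ≢ N
    s≢N s≡N = half∉S (subst (_∈ S) (trans (sym (mod-toℕ s)) (cong (_mod n) s≡N)) s∈S)

  vertexColour : Fin n → Colour
  vertexColour v = base (κ (toℕ v) (toℕ v))

  edgeColour : Edge → Colour
  edgeColour e = colour (toℕ (tail e)) (toℕ (head e)) (decode (toℕ (head e) ∸ toℕ (tail e)))

  -- An edge seen from its end v, with the step leading out of v; the conditions at a vertex then
  -- need not distinguish tails from heads.
  record Dart (v : Fin n) (e : Edge) : Set where
    field
      other  : Fin n
      c      : Step
      c-ok   : IsStep c
      c∈S    : inS (val c)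
      other≡ : toℕ other ≡ (toℕ v + val c) % n
      shaded : Shade (toℕ v) (toℕ other) c (edgeColour e)
      ends   : e Joins v , other

  module _ (e : Edge) where
    private
      u = tail e
      v = head e

      u<v : u Fin.< v
      u<v = tail<head e

      u~v : u ~ v
      u~v = tail~head e

      s : Fin n
      s = proj₁ u~v

      s∈S : s ∈ S
      s∈S = proj₁ (proj₂ u~v)

      v≡ : v ≡ (toℕ u + toℕ s) mod n
      v≡ = proj₂ (proj₂ u~v)

      c : Step
      c = decode (toℕ s)

      c-ok : IsStep c
      c-ok = proj₁ (step-of s∈S)

      val≡ : val c ≡ toℕ s
      val≡ = proj₂ (step-of s∈S)

      c∈S : inS (val c)
      c∈S = subst (_∈ S) (sym (trans (cong (_mod n) val≡) (mod-toℕ s))) s∈S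

      colour≡ : edgeColour e ≡ colour (toℕ u) (toℕ v) c
      colour≡ = cong (λ k → colour (toℕ u) (toℕ v) (decode k)) (difference≡ u v s u<v v≡)

      v≡u+c : toℕ v ≡ (toℕ u + val c) % n
      v≡u+c = trans (cong toℕ v≡)
        (trans (toℕ-mod (toℕ u + toℕ s) n) (cong (λ k → (toℕ u + k) % n) (sym val≡)))

      u≡v-c : toℕ u ≡ (toℕ v + val (reverse c)) % n
      u≡v-c = sym (begin
        (toℕ v + val (reverse c)) % n          ≡⟨ %-congʳ-+ (toℕ v) (toℕ u + val c) (val (reverse c)) n
                                                   (trans (m<n⇒m%n≡m (Fin.toℕ<n v)) v≡u+c) ⟩
        (toℕ u + val c + val (reverse c)) % n  ≡⟨ cong (_% n) (+-assoc (toℕ u) (val c) _) ⟩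
        (toℕ u + (val c + val (reverse c))) % n ≡⟨ cong (λ k → (toℕ u + k) % n) (val-reverse c-ok) ⟩
        (toℕ u + n) % n                        ≡⟨ [m+n]%n≡m%n (toℕ u) n ⟩
        toℕ u % n                              ≡⟨ m<n⇒m%n≡m (Fin.toℕ<n u) ⟩
        toℕ u                                  ∎)
        where open ≡-Reasoning

    tail-dart : Dart (tail e) e
    tail-dart = record
      { c-ok = c-ok ; c∈S = c∈S ; other≡ = v≡u+c
      ; shaded = subst (Shade _ _ c) (sym colour≡) (shade (toℕ u) (toℕ v) c)
      ; ends = inj₁ (refl , refl) }

    head-dart : Dart (head e) e
    head-dart = record
      { c-ok = reverse-isStep c-ok
      ; c∈S = inS-sym (val-reverse c-ok) (val>0 (reverse-isStep c-ok)) c∈S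
      ; other≡ = u≡v-c
      ; shaded = subst (Shade _ _ (reverse c))
          (sym (trans colour≡ (colour-reverse c-ok v≡u+c)))
          (shade (toℕ v) (toℕ u) (reverse c))
      ; ends = inj₂ (refl , refl) }

    dart : ∀ {w} → Incident w e → Dart w e
    dart (inj₁ refl) = tail-dart
    dart (inj₂ refl) = head-dart

  colourOf : Fin n ⊎ Edge → Colour
  colourOf (inj₁ v) = vertexColour v
  colourOf (inj₂ e) = edgeColour e

  colourOf-proper : ∀ x → Proper (colourOf x)
  colourOf-proper (inj₁ v) = ≤-pred (κ<1+N (toℕ v) (toℕ v))
  colourOf-proper (inj₂ e) = shade-proper c-ok shaded
    where open Dart (tail-dart e)

  colouring : Fin n ⊎ Edge → Fin n
  colouring x = encode (colourOf x) mod n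

  colouring-reflects : ∀ x y → colouring x ≡ colouring y → colourOf x ≡ colourOf y
  colouring-reflects x y eq = encode-injective (colourOf-proper x) (colourOf-proper y) (begin
    encode (colourOf x)  ≡⟨ toℕ-mod-< (encode<n (colourOf-proper x)) ⟨
    toℕ (colouring x)    ≡⟨ cong toℕ eq ⟩
    toℕ (colouring y)    ≡⟨ toℕ-mod-< (encode<n (colourOf-proper y)) ⟩
    encode (colourOf y)  ∎)
    where open ≡-Reasoning

  isTotalColouring : IsTotalColouring colouring
  isTotalColouring = record
    { vertex-vertex = λ u v u~v eq → vertex-vertex u v u~v (colouring-reflects (inj₁ u) (inj₁ v) eq)
    ; edge-edge     = λ e f (e≢f , v , v∈e , v∈f) eq →
        e≢f (edge-edge e f (dart e v∈e) (dart f v∈f) (colouring-reflects (inj₂ e) (inj₂ f) eq))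
    ; vertex-edge   = λ v e v∈e eq →
        vertex-edge v e (dart e v∈e) (colouring-reflects (inj₁ v) (inj₂ e) eq)
    }
    where
    vertex-vertex : ∀ u v → u ~ v → vertexColour u ≢ vertexColour v
    vertex-vertex u v (s , s∈S , refl) eq with step-of s∈S
    ... | c-ok , val≡ = vertex-vertex-≢ {toℕ u} c-ok (trans eq (cong (λ k → base (κ k k))
            (trans (toℕ-mod (toℕ u + toℕ s) n) (cong (λ k → (toℕ u + k) % n) (sym val≡)))))
    -- Equal colours at v give equal steps, hence equal other ends, hence the same edge.
    edge-edge : ∀ {v} e f → Dart v e → Dart v f → edgeColour e ≡ edgeColour f → e ≡ f
    edge-edge {v} e f a b eq = joins-unique e f A.ends
      (subst (λ w → f Joins v , w) (sym others) B.ends)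
      where
      module A = Dart a
      module B = Dart b
      steps : A.c ≡ B.c
      steps = locally-injective {toℕ v} A.c-ok B.c-ok A.c∈S B.c∈S
        (subst (λ w → Shade (toℕ v) w A.c (edgeColour e)) A.other≡ A.shaded)
        (subst (λ w → Shade (toℕ v) w B.c (edgeColour f)) B.other≡ B.shaded) eq
      others : A.other ≡ B.other
      others = Fin.toℕ-injective (trans A.other≡
        (trans (cong (λ c → (toℕ v + val c) % n) steps) (sym B.other≡)))
    vertex-edge : ∀ v e → Dart v e → vertexColour v ≢ edgeColour e
    vertex-edge v e a = vertex-edge-≢ c-ok
      (subst (λ w → Shade (toℕ v) w c (edgeColour e)) other≡ shaded)
      where open Dart a

  palette : Subset n
  palette = S ∪ (⁅ 0 mod n ⁆ ∪ ⁅ N mod n ⁆)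

  encoded∈palette : ∀ {k} → Palette k → k mod n ∈ palette
  encoded∈palette (inj₁ k∈S)         = x∈p∪q⁺ (inj₁ k∈S)
  encoded∈palette (inj₂ (inj₁ refl)) = x∈p∪q⁺ (inj₂ (x∈p∪q⁺ (inj₁ (x∈⁅x⁆ (0 mod n)))))
  encoded∈palette (inj₂ (inj₂ refl)) = x∈p∪q⁺ (inj₂ (x∈p∪q⁺ {p = ⁅ 0 mod n ⁆} (inj₂ (x∈⁅x⁆ (N mod n)))))

  colouring∈palette : ∀ x → colouring x ∈ palette
  colouring∈palette (inj₁ v) = encoded∈palette (base-palette (≤-pred (κ<1+N (toℕ v) (toℕ v))))
  colouring∈palette (inj₂ e) = encoded∈palette (shade-palette c-ok shaded)
    where open Dart (tail-dart e)

  χ″≤Δ+2 : χ″ G ≤ Δ + 2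
  χ″≤Δ+2 = χ″≤∣palette∣ G isTotalColouring palette colouring∈palette
    (≤-trans (∣p∪⁅x⁆∪⁅y⁆∣≤∣p∣+2 S (0 mod n) (N mod n)) (+-monoˡ-≤ 2 (∣S∣≤Δ (ℤ/ n) S S-gen)))

theorem3p1 :
    ∀ (n : ℕ) .{{_ : NonZero n}} → 2 ∣ n →
    ∀ (S : Subset n) (S-gen : IsSymmetricGeneratingSet (ℤ/ n) S) →
    let G  = Cay (ℤ/ n) S S-gen
        S₁ = cyclePowerSet n (n / 4)
    in
    Graph.Δ G ≥ n / 2 →
    ((n / 2) mod n) ∉ S →
    4 ∣ n → S₁ ⊆ S →
    Generates (ℤ/ n) (S ─ S₁) →
    χ″ G ≤ Graph.Δ G + 2
theorem3p1 n _ S S-gen _ half∉S (divides m refl) S₁⊆S _ =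
  Circulant.χ″≤Δ+2 m {{m*n≢0⇒m≢0 m}} S S-gen
    (subst (λ h → h mod n ∉ S) half half∉S)
    (subst (λ k → cyclePowerSet n k ⊆ S) (m*n/n≡m m 4) S₁⊆S)
  where
  double : ∀ m → m * 4 ≡ 2 * m * 2
  double = solve-∀
  half : n / 2 ≡ 2 * m
  half = trans (cong (_/ 2) (double m)) (m*n/n≡m (2 * m) 2)
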